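{- Let $G=(V,E)$ be a finite connected graph and let $(G,H)$ be any instance of Graphical House Allocation on $G$. Then every allocation $\pi$ is an $|E|$-approximation to the optimal value, i.e. $\mathrm{Envy}(\pi,G)\le |E|\cdot \min_{\pi'}\mathrm{Envy}(\pi',G)$, where the minimum is over all allocations $\pi'$.
   Context: An instance of Graphical House Allocation is a pair $(G,H)$, where $G=(V,E)$ is an undirected simple graph on $n$ vertices (agents) and $H=\{h_1,\dots,h_n\}$ is a multiset of $n$ nonnegative real numbers (house values). An allocation is a bijection $\pi:V\to H$ (each of the $n$ houses, counted with multiplicity, goes to exactly one vertex). Its envy is $\mathrm{Envy}(\pi,G)=\sum_{(i,j)\in E}|\pi(i)-\pi(j)|$. -}

module Defs where

open import Data.Nat as ℕ using (ℕ; zero; suc)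
import Data.Nat.Properties as ℕ
open import Data.Rational using (ℚ; 0ℚ; ½; _+_; _-_; -_; _*_; _⊓_; ∣_∣; _≤_; _<_)
import Data.Rational.Properties as ℚ
open import Data.Rational.Solver using (module +-*-Solver)
open import Data.Fin as Fin using (Fin)
open import Data.Fin.Permutation as Perm using (Permutation′; _⟨$⟩ʳ_; _≈_; insert; remove)
import Data.Fin.Properties as Fin
open import Data.List using (List; []; _∷_; [_]; map; foldr; filter; length; allFin; cartesianProduct; cartesianProductWith)
open import Data.List.Properties using (map-cong)
open import Data.List.Membership.Propositional using (_∈_)
open import Data.List.Membership.Propositional.Properties using (∈-allFin; ∈-cartesianProductWith⁺)
open import Data.List.Relation.Unary.Any using (here; there)
open import Data.Product using (_×_; _,_; ∃-syntax; Σ-syntax)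
open import Data.Sum using (inj₁; inj₂)
open import Level using (0ℓ)
open import Relation.Binary using (Rel; Decidable; Symmetric; Irreflexive)
open import Relation.Binary.Construct.Closure.ReflexiveTransitive using (Star)
open import Relation.Binary.PropositionalEquality using (_≡_; refl; sym; trans; cong; cong₂; subst)
open import Relation.Nullary using (yes; no)
open import Relation.Nullary.Decidable using (_×-dec_)

-- The standard library has no real numbers: they are taken here to be Cauchy
-- sequences of rationals, considered up to the equivalence induced by _≤ᴿ_.

IsCauchy : (ℕ → ℚ) → Set
IsCauchy x = ∀ ε → 0ℚ < ε →
  ∃[ N ] (∀ j k → N ℕ.≤ j → N ℕ.≤ k → ∣ x j - x k ∣ < ε)

record ℝ : Set where
  constructor mkℝ
  field
    seq    : ℕ → ℚ
    cauchy : IsCauchy seq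

open ℝ public

infix  4 _≤ᴿ_
infixl 6 _+ᴿ_ _-ᴿ_
infixl 7 _⊓ᴿ_
infixr 7 _·_

_≤ᴿ_ : ℝ → ℝ → Set
x ≤ᴿ y = ∀ ε → 0ℚ < ε →
  ∃[ N ] (∀ k → N ℕ.≤ k → seq x k ≤ seq y k + ε)

private
  ∣∣<-intro : ∀ {p ε} → p < ε → - p < ε → ∣ p ∣ < ε
  ∣∣<-intro {p} p<ε -p<ε with ℚ.∣p∣≡p∨∣p∣≡-p p
  ... | inj₁ eq = subst (_< _) (sym eq) p<ε
  ... | inj₂ eq = subst (_< _) (sym eq) -p<ε

  0<½*ε : ∀ {ε} → 0ℚ < ε → 0ℚ < ½ * ε
  0<½*ε {ε} 0<ε = subst (_< ½ * ε) (ℚ.*-zeroʳ ½) (ℚ.*-monoʳ-<-pos ½ 0<ε)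

  ½*ε+½*ε : ∀ ε → ½ * ε + ½ * ε ≡ ε
  ½*ε+½*ε ε = trans (sym (ℚ.*-distribʳ-+ ε ½ ½)) (ℚ.*-identityˡ ε)

  p≤∣p∣ : ∀ p → p ≤ ∣ p ∣
  p≤∣p∣ p with ℚ.≤-total 0ℚ p
  ... | inj₁ 0≤p = ℚ.≤-reflexive (sym (ℚ.0≤p⇒∣p∣≡p 0≤p))
  ... | inj₂ p≤0 = ℚ.≤-trans p≤0 (ℚ.0≤∣p∣ p)

  -[p-q] : ∀ p q → - (p - q) ≡ q - p
  -[p-q] = solve 2 (λ p q → :- (p :- q) := q :- p) refl
    where open +-*-Solver

  ∣p-q∣≡∣q-p∣ : ∀ p q → ∣ p - q ∣ ≡ ∣ q - p ∣
  ∣p-q∣≡∣q-p∣ p q = trans (sym (ℚ.∣-p∣≡∣p∣ (p - q))) (cong ∣_∣ (-[p-q] p q))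

  symmetrise : ∀ p q {ε} → p - q < ε → q - p < ε → ∣ p - q ∣ < ε
  symmetrise p q lt gt = ∣∣<-intro lt (subst (_< _) (sym (-[p-q] p q)) gt)

  ∣p∣-∣q∣≤∣p-q∣ : ∀ p q → ∣ p ∣ - ∣ q ∣ ≤ ∣ p - q ∣
  ∣p∣-∣q∣≤∣p-q∣ p q = begin
    ∣ p ∣ - ∣ q ∣               ≡⟨ cong (λ r → ∣ r ∣ - ∣ q ∣) (lemma₁ p q) ⟩
    ∣ (p - q) + q ∣ - ∣ q ∣     ≤⟨ ℚ.+-monoˡ-≤ (- ∣ q ∣) (ℚ.∣p+q∣≤∣p∣+∣q∣ (p - q) q) ⟩
    ∣ p - q ∣ + ∣ q ∣ - ∣ q ∣   ≡⟨ lemma₂ ∣ p - q ∣ ∣ q ∣ ⟩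
    ∣ p - q ∣                   ∎
    where
    open ℚ.≤-Reasoning
    open +-*-Solver
    lemma₁ : ∀ p q → p ≡ (p - q) + q
    lemma₁ = solve 2 (λ p q → p := (p :- q) :+ q) refl
    lemma₂ : ∀ p q → p + q - q ≡ p
    lemma₂ = solve 2 (λ p q → p :+ q :- q := p) refl

  ⊓-diff : ∀ a b c d {ε} → ∣ a - c ∣ < ε → ∣ b - d ∣ < ε → a ⊓ b - c ⊓ d < ε
  ⊓-diff a b c d ac bd with ℚ.⊓-sel c d
  ... | inj₁ eq rewrite eq = ℚ.≤-<-trans (ℚ.≤-trans (ℚ.+-monoˡ-≤ (- c) (ℚ.p⊓q≤p a b)) (p≤∣p∣ (a - c))) ac
  ... | inj₂ eq rewrite eq = ℚ.≤-<-trans (ℚ.≤-trans (ℚ.+-monoˡ-≤ (- d) (ℚ.p⊓q≤q a b)) (p≤∣p∣ (b - d))) bd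

0ᴿ : ℝ
0ᴿ = mkℝ (λ _ → 0ℚ) (λ ε 0<ε → 0 , λ _ _ _ _ → 0<ε)

_+ᴿ_ : ℝ → ℝ → ℝ
x +ᴿ y = mkℝ (λ k → seq x k + seq y k) λ ε 0<ε →
  let N₁ , p₁ = cauchy x (½ * ε) (0<½*ε 0<ε)
      N₂ , p₂ = cauchy y (½ * ε) (0<½*ε 0<ε)
  in N₁ ℕ.⊔ N₂ , λ j k N≤j N≤k → begin-strict
       ∣ seq x j + seq y j - (seq x k + seq y k) ∣
         ≡⟨ cong ∣_∣ (rearrange (seq x j) (seq y j) (seq x k) (seq y k)) ⟩
       ∣ (seq x j - seq x k) + (seq y j - seq y k) ∣
         ≤⟨ ℚ.∣p+q∣≤∣p∣+∣q∣ (seq x j - seq x k) (seq y j - seq y k) ⟩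
       ∣ seq x j - seq x k ∣ + ∣ seq y j - seq y k ∣
         <⟨ ℚ.+-mono-<
              (p₁ j k (ℕ.m⊔n≤o⇒m≤o N₁ N₂ N≤j) (ℕ.m⊔n≤o⇒m≤o N₁ N₂ N≤k))
              (p₂ j k (ℕ.m⊔n≤o⇒n≤o N₁ N₂ N≤j) (ℕ.m⊔n≤o⇒n≤o N₁ N₂ N≤k)) ⟩
       ½ * ε + ½ * ε
         ≡⟨ ½*ε+½*ε ε ⟩
       ε ∎
  where
  open ℚ.≤-Reasoning
  open +-*-Solver
  rearrange : ∀ a b c d → a + b - (c + d) ≡ (a - c) + (b - d)
  rearrange = solve 4 (λ a b c d → a :+ b :- (c :+ d) := (a :- c) :+ (b :- d)) refl

-ᴿ_ : ℝ → ℝ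
-ᴿ x = mkℝ (λ k → - seq x k) λ ε 0<ε →
  let N , p = cauchy x ε 0<ε
  in N , λ j k N≤j N≤k → subst (_< ε) (flip-sign (seq x j) (seq x k)) (p j k N≤j N≤k)
  where
  open +-*-Solver
  flip-sign : ∀ a b → ∣ a - b ∣ ≡ ∣ - a - - b ∣
  flip-sign a b = trans (∣p-q∣≡∣q-p∣ a b)
    (cong ∣_∣ (solve 2 (λ a b → b :- a := :- a :- (:- b)) refl a b))

_-ᴿ_ : ℝ → ℝ → ℝ
x -ᴿ y = x +ᴿ (-ᴿ y)

∣_∣ᴿ : ℝ → ℝ
∣ x ∣ᴿ = mkℝ (λ k → ∣ seq x k ∣) λ ε 0<ε →
  let N , p = cauchy x ε 0<ε
      one-sided = λ j k N≤j N≤k → ℚ.≤-<-trans (∣p∣-∣q∣≤∣p-q∣ (seq x j) (seq x k)) (p j k N≤j N≤k)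
  in N , λ j k N≤j N≤k → symmetrise ∣ seq x j ∣ ∣ seq x k ∣ (one-sided j k N≤j N≤k) (one-sided k j N≤k N≤j)

_⊓ᴿ_ : ℝ → ℝ → ℝ
x ⊓ᴿ y = mkℝ (λ k → seq x k ⊓ seq y k) λ ε 0<ε →
  let N₁ , p₁ = cauchy x ε 0<ε
      N₂ , p₂ = cauchy y ε 0<ε
      one-sided = λ j k N≤j N≤k → ⊓-diff (seq x j) (seq y j) (seq x k) (seq y k)
        (p₁ j k (ℕ.m⊔n≤o⇒m≤o N₁ N₂ N≤j) (ℕ.m⊔n≤o⇒m≤o N₁ N₂ N≤k))
        (p₂ j k (ℕ.m⊔n≤o⇒n≤o N₁ N₂ N≤j) (ℕ.m⊔n≤o⇒n≤o N₁ N₂ N≤k))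
  in N₁ ℕ.⊔ N₂ , λ j k N≤j N≤k → symmetrise (seq x j ⊓ seq y j) (seq x k ⊓ seq y k)
       (one-sided j k N≤j N≤k) (one-sided k j N≤k N≤j)

_·_ : ℕ → ℝ → ℝ
zero  · x = 0ᴿ
suc m · x = x +ᴿ m · x

sumᴿ : List ℝ → ℝ
sumᴿ = foldr _+ᴿ_ 0ᴿ

record Graph (n : ℕ) : Set₁ where
  field
    Adj        : Rel (Fin n) 0ℓ
    adj?       : Decidable Adj
    adj-sym    : Symmetric Adj
    adj-irrefl : Irreflexive _≡_ Adj

open Graph public

Connected : ∀ {n} → Graph n → Set
Connected G = ∀ u v → Star (Adj G) u v

-- Each undirected edge is listed exactly once, as the pair (i , j) with i < j.
edges : ∀ {n} → Graph n → List (Fin n × Fin n)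
edges {n} G = filter (λ (i , j) → (i Fin.<? j) ×-dec adj? G i j)
                     (cartesianProduct (allFin n) (allFin n))

∣E∣ : ∀ {n} → Graph n → ℕ
∣E∣ G = length (edges G)

-- A multiset of n values is given as an indexed family, which may repeat values.
record Houses (n : ℕ) : Set where
  field
    value    : Fin n → ℝ
    value-≥0 : ∀ i → 0ᴿ ≤ᴿ value i

open Houses public

-- An allocation is a bijection from vertices to house indices, so that houses of
-- equal value remain distinct items.
Allocation : ℕ → Set
Allocation n = Permutation′ n

Envy : ∀ {n} → Graph n → Houses n → Allocation n → ℝ
Envy G H π =
  sumᴿ (map (λ (i , j) → ∣ value H (π ⟨$⟩ʳ i) -ᴿ value H (π ⟨$⟩ʳ j) ∣ᴿ) (edges G))

-- All n! allocations, generated by choosing the house of vertex 0 and allocating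
-- the remaining houses recursively.
allocations : ∀ n → List (Allocation n)
allocations zero    = [ Perm.id ]
allocations (suc n) = cartesianProductWith (insert Fin.zero) (allFin (suc n)) (allocations n)

-- The identity allocation only serves as the starting value of the fold: the
-- minimum is over a nonempty family and needs no top element.
minEnvy : ∀ {n} → Graph n → Houses n → ℝ
minEnvy {n} G H = foldr _⊓ᴿ_ (Envy G H Perm.id) (map (Envy G H) (allocations n))

-- The remaining lemmas show that `minEnvy` is the greatest lower bound of the
-- envies of all allocations.

private
  insert-cong : ∀ {n} (j : Fin (suc n)) {π ρ : Permutation′ n} → π ≈ ρ →
                insert Fin.zero j π ≈ insert Fin.zero j ρ
  insert-cong j π≈ρ Fin.zero    = refl
  insert-cong j π≈ρ (Fin.suc k) = cong (Fin.punchIn j) (π≈ρ k)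

allocations-complete : ∀ {n} (π : Allocation n) → Σ[ ρ ∈ Allocation n ] (ρ ∈ allocations n × ρ ≈ π)
allocations-complete {zero}  π = Perm.id , here refl , λ ()
allocations-complete {suc n} π =
  let j = π ⟨$⟩ʳ Fin.zero
      ρ , ρ∈ , ρ≈ = allocations-complete (remove Fin.zero π)
  in insert Fin.zero j ρ
   , ∈-cartesianProductWith⁺ (insert Fin.zero) (∈-allFin j) ρ∈
   , λ k → trans (insert-cong j {ρ} {remove Fin.zero π} ρ≈ k) (Perm.insert-remove Fin.zero π k)

Envy-cong : ∀ {n} (G : Graph n) (H : Houses n) {π ρ : Allocation n} → π ≈ ρ →
            Envy G H π ≡ Envy G H ρ
Envy-cong G H π≈ρ = cong sumᴿ (map-cong
  (λ (i , j) → cong₂ (λ a b → ∣ value H a -ᴿ value H b ∣ᴿ) (π≈ρ i) (π≈ρ j)) (edges G))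

private
  p≤q⇒p≤q+ε : ∀ {p q ε} → 0ℚ < ε → p ≤ q → p ≤ q + ε
  p≤q⇒p≤q+ε {p} {q} {ε} 0<ε p≤q =
    subst (_≤ q + ε) (ℚ.+-identityʳ p) (ℚ.+-mono-≤ p≤q (ℚ.<⇒≤ 0<ε))

  foldr-⊓-lower : ∀ {A : Set} (f : A → ℝ) e {a} as → a ∈ as → ∀ k →
                  seq (foldr _⊓ᴿ_ e (map f as)) k ≤ seq (f a) k
  foldr-⊓-lower f e (b ∷ as) (here refl) k =
    ℚ.p⊓q≤p (seq (f b) k) (seq (foldr _⊓ᴿ_ e (map f as)) k)
  foldr-⊓-lower f e (b ∷ as) (there a∈)  k =
    ℚ.≤-trans (ℚ.p⊓q≤q (seq (f b) k) (seq (foldr _⊓ᴿ_ e (map f as)) k)) (foldr-⊓-lower f e as a∈ k)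

  ⊓ᴿ-glb : ∀ {x y z} → z ≤ᴿ x → z ≤ᴿ y → z ≤ᴿ x ⊓ᴿ y
  ⊓ᴿ-glb {x} {y} {z} z≤x z≤y ε 0<ε =
    let N₁ , p₁ = z≤x ε 0<ε
        N₂ , p₂ = z≤y ε 0<ε
    in N₁ ℕ.⊔ N₂ , λ k N≤k → below k
         (p₁ k (ℕ.m⊔n≤o⇒m≤o N₁ N₂ N≤k)) (p₂ k (ℕ.m⊔n≤o⇒n≤o N₁ N₂ N≤k))
    where
    below : ∀ k → seq z k ≤ seq x k + ε → seq z k ≤ seq y k + ε → seq z k ≤ seq x k ⊓ seq y k + ε
    below k p q with ℚ.⊓-sel (seq x k) (seq y k)
    ... | inj₁ eq rewrite eq = p
    ... | inj₂ eq rewrite eq = q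

minEnvy-lower : ∀ {n} (G : Graph n) (H : Houses n) (π : Allocation n) →
                minEnvy G H ≤ᴿ Envy G H π
minEnvy-lower {n} G H π ε 0<ε =
  let ρ , ρ∈ , ρ≈π = allocations-complete π
  in 0 , λ k _ → p≤q⇒p≤q+ε 0<ε
       (subst (λ e → seq (minEnvy G H) k ≤ seq e k) (Envy-cong G H {ρ} {π} ρ≈π)
         (foldr-⊓-lower (Envy G H) (Envy G H Perm.id) (allocations n) ρ∈ k))

minEnvy-greatest : ∀ {n} (G : Graph n) (H : Houses n) (x : ℝ) →
                   (∀ π → x ≤ᴿ Envy G H π) → x ≤ᴿ minEnvy G H
minEnvy-greatest {n} G H x lb = go (allocations n)
  where
  e = Envy G H Perm.id
  go : ∀ πs → x ≤ᴿ foldr _⊓ᴿ_ e (map (Envy G H) πs)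
  go []       = lb Perm.id
  go (π ∷ πs) = ⊓ᴿ-glb {Envy G H π} {foldr _⊓ᴿ_ e (map (Envy G H) πs)} {x} (lb π) (go πs)

{-# OPTIONS --safe #-}
-- At every index k the bound already holds for the rational approximations.
-- If f : V → ℚ, then |f u − f v| is at most the sum of |f i − f j| over all edges:
-- go along a walk from u to v, leave u for the last time along an edge u–w, and
-- repeat from w in the graph without the edges at u, which contain u–w.
-- repeat from w after deleting all edges at u, so that u–w is never counted twice.
-- every edge of any other allocation π by the envy of ρ.
module Submission where

open import Defs
open import Data.Nat using (ℕ)
open import Data.Fin as Fin using (Fin)
open import Data.Fin.Permutation using (_⟨$⟩ʳ_; _⟨$⟩ˡ_; inverseʳ)
import Data.Fin.Permutation as Perm
import Data.Fin.Properties as Fin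
open import Data.List using (List; []; _∷_; map; foldr; filter; length)
open import Data.List.Membership.Propositional using (_∈_; lose)
open import Data.List.Membership.Propositional.Properties using (∈-allFin; ∈-cartesianProduct⁺; ∈-filter⁺)
open import Data.List.Properties using (filter-reject; filter-notAll)
open import Data.List.Relation.Unary.Any using (here; there)
import Data.Nat as ℕ
import Data.Nat.Induction as ℕ
open import Data.Product using (_×_; _,_; proj₁; proj₂; ∃-syntax)
open import Data.Rational using (ℚ; 0ℚ; _+_; _-_; -_; ∣_∣; _≤_)
import Data.Rational.Properties as ℚ
open import Data.Rational.Solver using (module +-*-Solver)
open import Data.Sum as Sum using (_⊎_; inj₁; inj₂)
open import Induction.WellFounded using (Acc; acc)
open import Relation.Binary using (tri<; tri≈; tri>)
open import Relation.Binary.Construct.Closure.ReflexiveTransitive as Star using (Star; ε; _◅_)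
open import Relation.Binary.PropositionalEquality
open import Relation.Nullary using (¬_; yes; no; contradiction)
open import Relation.Nullary.Decidable using (¬?; _×-dec_)
open import Relation.Unary using (Decidable)

sumOver : ∀ {A : Set} → (A → ℚ) → List A → ℚ
sumOver w = foldr (λ x s → w x + s) 0ℚ

module _ {A : Set} (w : A → ℚ) (w≥0 : ∀ x → 0ℚ ≤ w x) where

  open ℚ.≤-Reasoning

  p≤w+p : ∀ x p → p ≤ w x + p
  p≤w+p x p = begin
    p        ≡⟨ ℚ.+-identityˡ p ⟨
    0ℚ + p   ≤⟨ ℚ.+-monoˡ-≤ p (w≥0 x) ⟩
    w x + p  ∎

  sumOver-≥0 : ∀ xs → 0ℚ ≤ sumOver w xs
  sumOver-≥0 []       = ℚ.≤-refl
  sumOver-≥0 (x ∷ xs) = ℚ.≤-trans (sumOver-≥0 xs) (p≤w+p x _)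

  module _ {P : A → Set} (P? : Decidable P) where

    sumOver-filter-≤ : ∀ xs → sumOver w (filter P? xs) ≤ sumOver w xs
    sumOver-filter-≤ []       = ℚ.≤-refl
    sumOver-filter-≤ (x ∷ xs) with P? x
    ... | yes _ = ℚ.+-monoʳ-≤ (w x) (sumOver-filter-≤ xs)
    ... | no  _ = ℚ.≤-trans (sumOver-filter-≤ xs) (p≤w+p x _)

    -- The filter drops the entry `x`, which pays for the term `w x`; whatever else it drops has
    -- nonnegative weight.
    w+sumOver-filter-≤ : ∀ {x xs} → x ∈ xs → ¬ P x →
                         w x + sumOver w (filter P? xs) ≤ sumOver w xs
    w+sumOver-filter-≤ {x} {_ ∷ xs} (here refl) ¬px
      rewrite filter-reject P? {xs = xs} ¬px = ℚ.+-monoʳ-≤ (w x) (sumOver-filter-≤ xs)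
    w+sumOver-filter-≤ {x} {y ∷ xs} (there x∈) ¬px with P? y
    ... | no  _ = ℚ.≤-trans (w+sumOver-filter-≤ x∈ ¬px) (p≤w+p y _)
    ... | yes _ = begin
      w x + (w y + s)      ≡⟨ ℚ.+-assoc (w x) (w y) s ⟨
      w x + w y + s        ≡⟨ cong (_+ s) (ℚ.+-comm (w x) (w y)) ⟩
      w y + w x + s        ≡⟨ ℚ.+-assoc (w y) (w x) s ⟩
      w y + (w x + s)      ≤⟨ ℚ.+-monoʳ-≤ (w y) (w+sumOver-filter-≤ x∈ ¬px) ⟩
      w y + sumOver w xs   ∎
      where s = sumOver w (filter P? xs)

module _ {n : ℕ} where

  -- `edges` stores each edge in one orientation only, while a walk may cross it either way.
  Link : List (Fin n × Fin n) → Fin n → Fin n → Set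
  Link L u v = (u , v) ∈ L ⊎ (v , u) ∈ L

  Avoids : Fin n → Fin n × Fin n → Set
  Avoids a (i , j) = a ≢ i × a ≢ j

  avoids? : ∀ a → Decidable (Avoids a)
  avoids? a (i , j) = ¬? (a Fin.≟ i) ×-dec ¬? (a Fin.≟ j)

  deleteVertex : Fin n → List (Fin n × Fin n) → List (Fin n × Fin n)
  deleteVertex a = filter (avoids? a)

  link-deleteVertex : ∀ {a u v L} → a ≢ u → a ≢ v → Link L u v → Link (deleteVertex a L) u v
  link-deleteVertex {a} a≢u a≢v =
    Sum.map (λ e∈ → ∈-filter⁺ (avoids? a) e∈ (a≢u , a≢v)) (λ e∈ → ∈-filter⁺ (avoids? a) e∈ (a≢v , a≢u))

  -- Induction along the walk, with the start `u` kept general: either the walk never meets `a`, so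
  -- all its links survive the deletion, or it has a last departure from `a`, after which they do.
  lastExit : ∀ {a u b L} → a ≢ b → Star (Link L) u b →
             (a ≢ u × Star (Link (deleteVertex a L)) u b)
             ⊎ (∃[ c ] Link L a c × Star (Link (deleteVertex a L)) c b)
  lastExit a≢b ε = inj₁ (a≢b , ε)
  lastExit {a} {u} a≢b (u–v ◅ walk) with lastExit a≢b walk
  -- An exit found in the tail comes later than any at `u`, so it takes precedence.
  ... | inj₂ exit = inj₂ exit
  ... | inj₁ (a≢v , walk′) with a Fin.≟ u
  ...   | yes refl = inj₂ (_ , u–v , walk′)
  ...   | no  a≢u  = inj₁ (a≢u , link-deleteVertex a≢u a≢v u–v ◅ walk′)

  module _ (f : Fin n → ℚ) where

    gap : Fin n × Fin n → ℚ
    gap (i , j) = ∣ f i - f j ∣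

    gap-≥0 : ∀ e → 0ℚ ≤ gap e
    gap-≥0 (i , j) = ℚ.0≤∣p∣ (f i - f j)

    gap-refl : ∀ i → gap (i , i) ≡ 0ℚ
    gap-refl i = cong ∣_∣ (ℚ.+-inverseʳ (f i))

    gap-sym : ∀ i j → gap (i , j) ≡ gap (j , i)
    gap-sym i j = begin
      ∣ f i - f j ∣      ≡⟨ ℚ.∣-p∣≡∣p∣ (f i - f j) ⟨
      ∣ - (f i - f j) ∣  ≡⟨ cong ∣_∣ (solve 2 (λ p q → :- (p :- q) := q :- p) refl (f i) (f j)) ⟩
      ∣ f j - f i ∣      ∎
      where
      open ≡-Reasoning
      open +-*-Solver

    gap-triangle : ∀ i j k → gap (i , k) ≤ gap (i , j) + gap (j , k)
    gap-triangle i j k = begin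
      ∣ f i - f k ∣                  ≡⟨ cong ∣_∣ (solve 3 (λ p q r → p :- r := (p :- q) :+ (q :- r)) refl (f i) (f j) (f k)) ⟩
      ∣ (f i - f j) + (f j - f k) ∣  ≤⟨ ℚ.∣p+q∣≤∣p∣+∣q∣ (f i - f j) (f j - f k) ⟩
      gap (i , j) + gap (j , k)      ∎
      where
      open ℚ.≤-Reasoning
      open +-*-Solver

    -- Picks the orientation actually listed; both have the same gap, and both are removed by
    -- `deleteVertex u`.
    link-orient : ∀ {L u v} → Link L u v →
                  ∃[ e ] e ∈ L × ¬ Avoids u e × gap e ≡ gap (u , v)
    link-orient (inj₁ e∈) = _ , e∈ , (λ avoids → proj₁ avoids refl) , refl
    link-orient {u = u} {v} (inj₂ e∈) = _ , e∈ , (λ avoids → proj₂ avoids refl) , gap-sym v u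

    -- The recursion is on the length of `L`, since `walk′` is rebuilt over the filtered list and is
    -- no subterm of `walk`. The list shrinks because it loses at least the exit edge `e`.
    walk-gap-≤ : ∀ {L a b} → Acc ℕ._<_ (length L) → Star (Link L) a b → gap (a , b) ≤ sumOver gap L
    walk-gap-≤ {L} {a} {b} (acc rec) walk with a Fin.≟ b
    ... | yes refl = subst (_≤ sumOver gap L) (sym (gap-refl a)) (sumOver-≥0 gap gap-≥0 L)
    ... | no a≢b with lastExit a≢b walk
    -- The walk starts at `a`, so it cannot avoid `a`.
    ...   | inj₁ (a≢a , _) = contradiction refl a≢a
    ...   | inj₂ (c , a–c , walk′) with link-orient a–c
    ...     | e , e∈ , ¬avoids , gap-e≡ = begin
      gap (a , b)                                   ≤⟨ gap-triangle a c b ⟩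
      gap (a , c) + gap (c , b)                     ≤⟨ ℚ.+-monoʳ-≤ (gap (a , c)) (walk-gap-≤ (rec shorter) walk′) ⟩
      gap (a , c) + sumOver gap (deleteVertex a L)  ≡⟨ cong (_+ sumOver gap (deleteVertex a L)) gap-e≡ ⟨
      gap e + sumOver gap (deleteVertex a L)        ≤⟨ w+sumOver-filter-≤ gap gap-≥0 (avoids? a) e∈ ¬avoids ⟩
      sumOver gap L                                 ∎
      where
      open ℚ.≤-Reasoning
      shorter : length (deleteVertex a L) ℕ.< length L
      shorter = filter-notAll (avoids? a) L (lose e∈ ¬avoids)

module _ {n : ℕ} (G : Graph n) where

  ∈-edges⁺ : ∀ {u v} → u Fin.< v → Adj G u v → (u , v) ∈ edges G
  ∈-edges⁺ {u} {v} u<v u–v =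
    ∈-filter⁺ (λ (i , j) → (i Fin.<? j) ×-dec adj? G i j)
      (∈-cartesianProduct⁺ (∈-allFin u) (∈-allFin v)) (u<v , u–v)

  adj⇒link : ∀ {u v} → Adj G u v → Link (edges G) u v
  adj⇒link {u} {v} u–v with Fin.<-cmp u v
  ... | tri< u<v _ _ = inj₁ (∈-edges⁺ u<v u–v)
  ... | tri≈ _ u≡v _ = contradiction u–v (adj-irrefl G u≡v)
  ... | tri> _ _ v<u = inj₂ (∈-edges⁺ v<u (adj-sym G u–v))

  connected-gap-≤ : Connected G → ∀ f u v → gap f (u , v) ≤ sumOver (gap f) (edges G)
  connected-gap-≤ conn f u v = walk-gap-≤ f (ℕ.<-wellFounded _) (Star.map adj⇒link (conn u v))

module _ {A : Set} (k : ℕ) where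

  seq-sumᴿ : ∀ (F : A → ℝ) xs → seq (sumᴿ (map F xs)) k ≡ sumOver (λ x → seq (F x) k) xs
  seq-sumᴿ F []       = refl
  seq-sumᴿ F (x ∷ xs) = cong (seq (F x) k +_) (seq-sumᴿ F xs)

  seq-sumᴿ-≤ : ∀ (F : A → ℝ) y → (∀ x → seq (F x) k ≤ seq y k) →
               ∀ xs → seq (sumᴿ (map F xs)) k ≤ seq (length xs · y) k
  seq-sumᴿ-≤ F y F≤y []       = ℚ.≤-refl
  seq-sumᴿ-≤ F y F≤y (x ∷ xs) = ℚ.+-mono-≤ (F≤y x) (seq-sumᴿ-≤ F y F≤y xs)

  -- An exact form of the greatest-lower-bound property at a single index, with no `ε` to carry.
  seq-foldr-⊓-greatest : ∀ (F : A → ℝ) {p e} → p ≤ seq e k → (∀ x → p ≤ seq (F x) k) →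
                         ∀ xs → p ≤ seq (foldr _⊓ᴿ_ e (map F xs)) k
  seq-foldr-⊓-greatest F p≤e p≤F []       = p≤e
  seq-foldr-⊓-greatest F p≤e p≤F (x ∷ xs) = ℚ.⊓-glb (p≤F x) (seq-foldr-⊓-greatest F p≤e p≤F xs)

seq-≤⇒≤ᴿ : ∀ {x y} → (∀ k → seq x k ≤ seq y k) → x ≤ᴿ y
seq-≤⇒≤ᴿ {x} {y} x≤y δ 0<δ = 0 , λ k _ →
  subst (_≤ seq y k + δ) (ℚ.+-identityʳ (seq x k)) (ℚ.+-mono-≤ (x≤y k) (ℚ.<⇒≤ 0<δ))

module _ {n : ℕ} (G : Graph n) (conn : Connected G) (H : Houses n) (k : ℕ) where

  -- Under `ρ` the houses `s` and `t` belong to two vertices, which connectedness joins by a walk.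
  -- As the bound is stated for houses, it applies to pairs that a different allocation makes
  -- adjacent.
  house-gap-≤-Envy : ∀ ρ s t → ∣ seq (value H s) k - seq (value H t) k ∣ ≤ seq (Envy G H ρ) k
  house-gap-≤-Envy ρ s t = begin
    ∣ val s - val t ∣            ≡⟨ cong₂ (λ x y → ∣ val x - val y ∣) (inverseʳ ρ) (inverseʳ ρ) ⟨
    gap f (ρ ⟨$⟩ˡ s , ρ ⟨$⟩ˡ t)  ≤⟨ connected-gap-≤ G conn f (ρ ⟨$⟩ˡ s) (ρ ⟨$⟩ˡ t) ⟩
    -- Entry `k` of each summand of `Envy` unfolds to `gap f` of the edge.
    sumOver (gap f) (edges G)    ≡⟨ seq-sumᴿ k _ (edges G) ⟨
    seq (Envy G H ρ) k           ∎
    where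
    open ℚ.≤-Reasoning
    val : Fin n → ℚ
    val s = seq (value H s) k
    f : Fin n → ℚ
    f v = val (ρ ⟨$⟩ʳ v)

  house-gap-≤-minEnvy : ∀ s t → ∣ seq (value H s) k - seq (value H t) k ∣ ≤ seq (minEnvy G H) k
  house-gap-≤-minEnvy s t = seq-foldr-⊓-greatest k (Envy G H)
    -- The first bound is for the starting value of the fold.
    (house-gap-≤-Envy Perm.id s t) (λ ρ → house-gap-≤-Envy ρ s t) (allocations n)

proposition3p1 : ∀ (n : ℕ) (G : Graph n) → Connected G → (H : Houses n) (π : Allocation n) →
    Envy G H π ≤ᴿ ∣E∣ G · minEnvy G H
proposition3p1 n G conn H π = seq-≤⇒≤ᴿ {Envy G H π} {∣E∣ G · minEnvy G H} λ k →
  -- Each edge contributes one copy of `minEnvy G H`, and `∣E∣ G` is by definition the length of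
  -- `edges G`.
  seq-sumᴿ-≤ k _ (minEnvy G H) (λ (i , j) → house-gap-≤-minEnvy G conn H k (π ⟨$⟩ʳ i) (π ⟨$⟩ʳ j)) (edges G)
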